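{- For any non-trivial tree $T$, $\alpha(T) = DD_{\mathrm{m}}(T)$ if and only if $T$ is a weak tree and $S(T) = |V(T)|/2$.
   Context: Graphs are finite, simple and undirected; a graph is non-trivial if it has at least two vertices. $\alpha(G)$ is the independence number. A weak graph is one in which no vertex is adjacent to two or more vertices of degree one. Swap number: a dominating set $D$ of a graph $G$ is a swap set if there is a dominating set $D'$ of $G$ with $D\cap D'=\emptyset$, $|D|=|D'|$, such that $G$ contains a perfect matching between $D$ and $D'$ (a bijection $f:D\to D'$ with $x f(x)\in E(G)$ for all $x\in D$). $DD_{\mathrm{m}}(G)$ is the minimum cardinality of a swap set of $G$, and $DD_{\mathrm{m}}(G)=\infty$ if none exists. Simple star partitioning: a star is $K_{1,n}$, $n\ge 1$; a single vertex $K_1$ is also allowed as a (degenerate) star part of order 1. A leaf is a vertex of degree one. A simple star partitioning $P$ of a non-trivial tree $T$ is a partition of $V(T)$ such that (i) each part induces a star (possibly $K_1$); (ii) each vertex of $T$ adjacent to exactly one leaf forms a $K_2$ part of $P$ together with this leaf; (iii) any $K_1$ part is adjacent to at least two parts that are not $K_1$'s (two parts are adjacent if some edge of $T$ joins them). A part of order $k$ has weight $k-1$; the weight of $P$ is the sum of the weights of its parts. $S(T)$ is the minimum weight of a simple star partitioning of $T$. -}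

module Defs where

open import Data.Fin using (Fin; zero; suc; inject₁; fromℕ)
open import Data.Fin.Subset using (Subset; _∈_; ∣_∣; _∩_; _∪_; ⁅_⁆; Nonempty; Empty)
open import Data.List using (sum; tabulate)
open import Data.Nat using (ℕ; _+_; _∸_; _≤_)
open import Data.Product using (Σ; ∃; ∃-syntax; ∃!; _×_; proj₁)
open import Data.Sum using (_⊎_)
open import Data.Vec as Vec using ()
open import Function.Bundles using (_⤖_; Bijection)
open import Function.Definitions using (Injective)
open import Relation.Binary using (Rel; Symmetric; Decidable)
open import Relation.Binary.Construct.Closure.ReflexiveTransitive using (Star)
open import Relation.Binary.PropositionalEquality using (_≡_; _≢_)
open import Relation.Nullary using (¬_; does)
open import Relation.Nullary.Construct.Add.Supremum using (_⁺; [_]; ⊤⁺)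
open import Level using (0ℓ)

IsMinimum : {A : Set} → (A → Set) → (A → ℕ) → ℕ → Set
IsMinimum P f k = (∃[ x ] (P x × f x ≡ k)) × (∀ x → P x → k ≤ f x)

IsMaximum : {A : Set} → (A → Set) → (A → ℕ) → ℕ → Set
IsMaximum P f k = (∃[ x ] (P x × f x ≡ k)) × (∀ x → P x → f x ≤ k)

record Graph (n : ℕ) : Set₁ where
  field
    Adj    : Rel (Fin n) 0ℓ
    adj?   : Decidable Adj
    sym    : Symmetric Adj
    irrefl : ∀ {v} → ¬ Adj v v

record Partition (n : ℕ) : Set where
  field
    size     : ℕ
    part     : Fin size → Subset n
    nonempty : ∀ i → Nonempty (part i)
    covers   : ∀ v → ∃! _≡_ (λ i → v ∈ part i)

weight : ∀ {n} → Partition n → ℕ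
weight P = sum (tabulate (λ i → ∣ part i ∣ ∸ 1))
  where open Partition P

module _ {n : ℕ} (G : Graph n) where
  open Graph G

  neighbours : Fin n → Subset n
  neighbours v = Vec.tabulate (λ u → does (adj? v u))

  degree : Fin n → ℕ
  degree v = ∣ neighbours v ∣

  Leaf : Fin n → Set
  Leaf v = degree v ≡ 1

  Connected : Set
  Connected = ∀ u v → Star Adj u v

  -- c lists the vertices of a cycle of length 3 + k in cyclic order.
  IsCycle : ∀ {k} → (Fin (3 + k) → Fin n) → Set
  IsCycle {k} c =
      Injective _≡_ _≡_ c
    × (∀ (i : Fin (2 + k)) → Adj (c (inject₁ i)) (c (suc i)))
    × Adj (c (fromℕ (2 + k))) (c zero)

  Acyclic : Set
  Acyclic = ∀ {k} (c : Fin (3 + k) → Fin n) → ¬ IsCycle c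

  -- Connected holds for the graph on no vertices, so a lower bound on n
  -- has to be assumed separately.
  IsTree : Set
  IsTree = Connected × Acyclic

  IsWeak : Set
  IsWeak = ¬ (∃[ v ] ∃[ u ] ∃[ w ] (u ≢ w × Adj v u × Adj v w × Leaf u × Leaf w))

  Independent : Subset n → Set
  Independent I = ∀ {u v} → u ∈ I → v ∈ I → ¬ Adj u v

  IsIndependenceNumber : ℕ → Set
  IsIndependenceNumber = IsMaximum Independent ∣_∣

  Dominating : Subset n → Set
  Dominating D = ∀ v → v ∈ D ⊎ (∃[ u ] (u ∈ D × Adj u v))

  PerfectMatching : Subset n → Subset n → Set
  PerfectMatching D D′ =
    Σ (∃ (_∈ D) ⤖ ∃ (_∈ D′)) λ f →
      ∀ x → Adj (proj₁ x) (proj₁ (Bijection.to f x))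

  SwapSet : Subset n → Set
  SwapSet D =
    Dominating D ×
    (∃[ D′ ] (Dominating D′ × Empty (D ∩ D′) × ∣ D ∣ ≡ ∣ D′ ∣ × PerfectMatching D D′))

  -- ⊤⁺ is the value ∞.
  IsSwapNumber : ℕ ⁺ → Set
  IsSwapNumber [ k ] = IsMinimum SwapSet ∣_∣ k
  IsSwapNumber ⊤⁺    = ∀ D → ¬ SwapSet D

  -- c is the centre; ∣ S ∣ ≡ 1 gives the degenerate star K₁.
  InducesStar : Subset n → Set
  InducesStar S =
    ∃[ c ] ( c ∈ S
           × (∀ {u} → u ∈ S → u ≢ c → Adj c u)
           × (∀ {u w} → u ∈ S → w ∈ S → u ≢ c → w ≢ c → ¬ Adj u w))

  OnlyLeafOf : Fin n → Fin n → Set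
  OnlyLeafOf v l = Adj v l × Leaf l × (∀ {l′} → Adj v l′ → Leaf l′ → l′ ≡ l)

  PartsAdjacent : Subset n → Subset n → Set
  PartsAdjacent A B = ∃[ u ] ∃[ v ] (u ∈ A × v ∈ B × Adj u v)

  record IsSimpleStarPartitioning (P : Partition n) : Set where
    open Partition P
    field
      stars     : ∀ i → InducesStar (part i)
      leafPairs : ∀ v l → OnlyLeafOf v l → ∃[ i ] part i ≡ ⁅ v ⁆ ∪ ⁅ l ⁆
      isolated  : ∀ i → ∣ part i ∣ ≡ 1 →
                  ∃[ j ] ∃[ k ] ( j ≢ k
                                × ∣ part j ∣ ≢ 1 × PartsAdjacent (part i) (part j)
                                × ∣ part k ∣ ≢ 1 × PartsAdjacent (part i) (part k))

  IsStarWeight : ℕ → Set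
  IsStarWeight = IsMinimum IsSimpleStarPartitioning weight

{-# OPTIONS --safe #-}

-- A weak tree T satisfies DD_m(T) = S(T). Given a swap set D matched to D′, the
-- matching edges together with the unmatched vertices as K₁ parts form a simple
-- star partitioning of weight |D|. Conversely, the ends of a star with at least
-- three vertices can be detached one by one without increasing the weight: such
-- an end is not a leaf, so it either has a K₁ neighbour to be paired with, or
-- becomes a K₁ part itself. What remains is a matching in which every unmatched
-- vertex x has two matched neighbours p x and q x. Since T is a tree, its
-- vertices can be coloured with two colours so that every edge changes colour
-- except the edges from x to p x; the two colour classes of the matched vertices
-- are then D and D′.
--
-- Always 2 DD_m(T) ≤ |V(T)| ≤ 2 α(T), as T is bipartite. Hence α(T) = DD_m(T)
-- forces both to be |V(T)| / 2, and the existence of a swap set forces T to be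
-- weak. If DD_m(T) = |V(T)| / 2, then T has a perfect matching, so that
-- α(T) ≤ |V(T)| / 2.
module Submission where

open import Defs
open import Data.Bool using (Bool; true; false; not; _xor_; _∨_; if_then_else_)
open import Data.Bool.Properties as Bool using (∨-comm; ¬-not; not-¬)
open import Data.Fin using (Fin; zero; suc; inject₁; fromℕ)
open import Data.Fin.Properties using (_≟_; any?; suc-injective; 0≢1+n)
open import Data.Fin.Subset using (Subset; inside; outside; _∈_; _∉_; _⊆_; ∣_∣; _∩_; _∪_; _─_; _-_; ⊤; ⁅_⁆)
open import Data.Fin.Subset.Properties using (_∈?_; x∈p⇒∣p-x∣<∣p∣; x∈p∧x≢y⇒x∈p-y; x∈p∧x∉q⇒x∈p─q; p─q⊆p; p⊆q⇒∣p∣≤∣q∣; Empty-unique; ∣⊥∣≡0; x∈p∩q⁺; x∈p∩q⁻; p∩q⊆q; x∈p∪q⁺; x∈p∪q⁻; x∈⁅x⁆; x∈⁅y⁆⇒x≡y; ∣⁅x⁆∣≡1; ⊆-antisym; ∣p∣≡n⇒p≡⊤; ∈⊤; ∣⊤∣≡n; ∣p∣≤n)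
open import Data.List using (List; []; _∷_; length; lookup; filter; allFin; tabulate)
open import Data.List.Membership.DecPropositional using () renaming (_∈?_ to member?)
open import Data.List.Membership.Propositional using () renaming (_∈_ to _∈ₗ_; _∉_ to _∉ₗ_)
open import Data.List.Membership.Propositional.Properties using (∈-allFin; ∈-filter⁺; ∈-filter⁻; ∈-lookup)
open import Data.List.Relation.Unary.All as All using ()
open import Data.List.Relation.Unary.AllPairs as AllPairs using ()
open import Data.List.Relation.Unary.Any as Any using (here; there)
open import Data.List.Relation.Unary.Any.Properties using (lookup-index)
open import Data.List.Relation.Unary.Unique.Propositional using (Unique)
open import Data.List.Relation.Unary.Unique.Propositional.Properties using (allFin⁺; filter⁺)
open import Data.Nat using (ℕ; suc; _+_; _∸_; _*_; _≤_; z≤n; s≤s)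
open import Data.Nat.ListAction using (sum)
open import Data.Nat.Properties as ℕ using (≤-trans; ≤-reflexive; ≤-antisym; +-mono-≤; +-suc)
open import Data.Product using (∃-syntax; _×_; _,_; proj₁; proj₂)
open import Data.Sum using (_⊎_; inj₁; inj₂; [_,_]′)
open import Data.Vec as Vec using (_∷_; here; there)
open import Data.Vec.Properties using (lookup∘tabulate; lookup⇒[]=; []=⇒lookup)
open import Data.Vec.Properties.WithK using ([]=-irrelevant)
open import Function using (_∘_; id; case_of_)
open import Function.Bundles using (_⇔_; mk⇔; mk↔ₛ′; Inverse)
open import Function.Properties.Bijection using (⤖⇒↔)
open import Function.Properties.Inverse using (↔⇒⤖)
open import Relation.Binary.Construct.Closure.ReflexiveTransitive as Star using (Star; ε; _◅_; _◅◅_)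
open import Relation.Binary.PropositionalEquality using (_≡_; _≢_; refl; sym; trans; cong; cong₂; subst; ≢-sym)
open import Relation.Nullary using (¬_; Dec; yes; no; does; contradiction)
open import Relation.Nullary.Decidable using (_×-dec_; ¬?; dec-true; dec-false)
open import Relation.Nullary.Construct.Add.Supremum using ([_])
open import Relation.Unary using (Pred; Decidable)
open import Level using (0ℓ)

-- Finite sets

module _ {n : ℕ} {P : Pred (Fin n) 0ℓ} (P? : Decidable P) where

  subset : Subset n
  subset = Vec.tabulate (does ∘ P?)

  ∈-subset⁺ : ∀ {v} → P v → v ∈ subset
  ∈-subset⁺ {v} Pv =
    lookup⇒[]= v subset (trans (lookup∘tabulate (does ∘ P?) v) (dec-true (P? v) Pv))

  ∈-subset⁻ : ∀ {v} → v ∈ subset → P v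
  ∈-subset⁻ {v} v∈ with P? v | trans (sym (lookup∘tabulate (does ∘ P?) v)) ([]=⇒lookup v∈)
  ... | yes Pv | _  = Pv
  ... | no  _  | ()

-- Induction on `p`: the value at its first element is deleted from `q`, and injectivity keeps the
-- later values away from it. Injectivity is asked on `p` only, since the maps used below are
-- defined by cases on all vertices.
∣∣-injection : ∀ {m n} (p : Subset m) (q : Subset n) (g : Fin m → Fin n) →
               (∀ {x} → x ∈ p → g x ∈ q) →
               (∀ {x y} → x ∈ p → y ∈ p → g x ≡ g y → x ≡ y) →
               ∣ p ∣ ≤ ∣ q ∣
∣∣-injection Vec.[] q g into inj = z≤n
∣∣-injection (outside ∷ p) q g into inj =
  ∣∣-injection p q (g ∘ suc) (into ∘ there)
    (λ x∈ y∈ → suc-injective ∘ inj (there x∈) (there y∈))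
∣∣-injection (inside ∷ p) q g into inj =
  ≤-trans (s≤s (∣∣-injection p (q - g zero) (g ∘ suc)
                  (λ x∈ → x∈p∧x≢y⇒x∈p-y (into (there x∈))
                            (λ eq → 0≢1+n (inj here (there x∈) (sym eq))))
                  (λ x∈ y∈ → suc-injective ∘ inj (there x∈) (there y∈))))
          (x∈p⇒∣p-x∣<∣p∣ (into here))

∣∣-split : ∀ {n} (p q : Subset n) → ∣ p ∣ ≡ ∣ p ∩ q ∣ + ∣ p ─ q ∣
∣∣-split Vec.[] Vec.[] = refl
∣∣-split (inside  ∷ p) (inside  ∷ q) = cong suc (∣∣-split p q)
∣∣-split (inside  ∷ p) (outside ∷ q) = trans (cong suc (∣∣-split p q)) (sym (+-suc _ _))
∣∣-split (outside ∷ p) (inside  ∷ q) = ∣∣-split p q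
∣∣-split (outside ∷ p) (outside ∷ q) = ∣∣-split p q

x∈p─q⇒x∉q : ∀ {n x} (p q : Subset n) → x ∈ p ─ q → x ∉ q
x∈p─q⇒x∉q (_ ∷ p) (_ ∷ q) (there x∈) (there x∈q) = x∈p─q⇒x∉q p q x∈ x∈q
x∈p─q⇒x∉q (inside  ∷ p) (_ ∷ q) () here
x∈p─q⇒x∉q (outside ∷ p) (_ ∷ q) () here

∣∣-disjoint : ∀ {n} {p q r : Subset n} → p ⊆ r → q ⊆ r →
              (∀ {x} → x ∈ p → x ∉ q) → ∣ p ∣ + ∣ q ∣ ≤ ∣ r ∣
∣∣-disjoint {p = p} {q} {r} p⊆r q⊆r disj =
  ≤-trans (+-mono-≤ (p⊆q⇒∣p∣≤∣q∣ (λ x∈p → x∈p∩q⁺ (p⊆r x∈p , x∈p)))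
                    (p⊆q⇒∣p∣≤∣q∣ (λ x∈q → x∈p∧x∉q⇒x∈p─q (q⊆r x∈q) (λ x∈p → disj x∈p x∈q))))
          (≤-reflexive (sym (∣∣-split r p)))

∣∣-cover : ∀ {n} {p q r : Subset n} → (∀ {x} → x ∈ r → x ∈ p ⊎ x ∈ q) →
           ∣ r ∣ ≤ ∣ p ∣ + ∣ q ∣
∣∣-cover {p = p} {q} {r} cover =
  ≤-trans (≤-reflexive (∣∣-split r p))
          (+-mono-≤ (p⊆q⇒∣p∣≤∣q∣ (λ x∈ → p∩q⊆q r p x∈))
                    (p⊆q⇒∣p∣≤∣q∣ (λ x∈ → case cover (p─q⊆p r p x∈) of λ where
                       (inj₁ x∈p) → contradiction x∈p (x∈p─q⇒x∉q r p x∈)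
                       (inj₂ x∈q) → x∈q)))

∣p∣≡1⇒x≡y : ∀ {n} {p : Subset n} → ∣ p ∣ ≡ 1 → ∀ {x y} → x ∈ p → y ∈ p → x ≡ y
∣p∣≡1⇒x≡y {p = p} ∣p∣≡1 {x} {y} x∈p y∈p with x ≟ y
... | yes x≡y = x≡y
... | no  x≢y = contradiction (subst (2 ≤_) ∣p∣≡1 two) λ { (s≤s ()) }
  where
  two : 2 ≤ ∣ p ∣
  two = ≤-trans (+-mono-≤ (≤-reflexive (sym (∣⁅x⁆∣≡1 x))) (≤-reflexive (sym (∣⁅x⁆∣≡1 y))))
          (∣∣-disjoint (λ z∈ → subst (_∈ p) (sym (x∈⁅y⁆⇒x≡y x z∈)) x∈p)
                       (λ z∈ → subst (_∈ p) (sym (x∈⁅y⁆⇒x≡y y z∈)) y∈p)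
                       (λ z∈x z∈y → x≢y (trans (sym (x∈⁅y⁆⇒x≡y x z∈x)) (x∈⁅y⁆⇒x≡y y z∈y))))

≡⇒∣p∣≡1 : ∀ {n} {p : Subset n} {x} → x ∈ p → (∀ {y} → y ∈ p → y ≡ x) → ∣ p ∣ ≡ 1
≡⇒∣p∣≡1 {p = p} {x} x∈p all≡x = trans (cong ∣_∣ p≡⁅x⁆) (∣⁅x⁆∣≡1 x)
  where
  p≡⁅x⁆ : p ≡ ⁅ x ⁆
  p≡⁅x⁆ = ⊆-antisym (λ y∈ → subst (_∈ ⁅ x ⁆) (sym (all≡x y∈)) (x∈⁅x⁆ x))
                    (λ y∈ → subst (_∈ p) (sym (x∈⁅y⁆⇒x≡y x y∈)) x∈p)

-- Together with `sum-disjoint` this compares a weight with a number of vertices: `A i` will be a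
-- part without its centre, and `a i` the order of that part minus one.
sum-cover : ∀ {n k} (a : Fin k → ℕ) (A : Fin k → Subset n) (r : Subset n) →
            (∀ i → ∣ A i ∣ ≤ a i) → (∀ {x} → x ∈ r → ∃[ i ] x ∈ A i) →
            ∣ r ∣ ≤ sum (tabulate a)
sum-cover {n} {0} a A r A≤a cover =
  ≤-reflexive (trans (cong ∣_∣ (Empty-unique λ { (x , x∈) → case cover x∈ of λ { (() , _) } })) (∣⊥∣≡0 n))
sum-cover {k = suc k} a A r A≤a cover =
  ≤-trans (∣∣-cover {p = A zero} {r ─ A zero} {r} here-or-later)
          (+-mono-≤ (A≤a zero) (sum-cover (a ∘ suc) (A ∘ suc) (r ─ A zero) (A≤a ∘ suc) later))
  where
  here-or-later : ∀ {x} → x ∈ r → x ∈ A zero ⊎ x ∈ r ─ A zero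
  here-or-later {x} x∈ with x ∈? A zero
  ... | yes x∈A = inj₁ x∈A
  ... | no  x∉A = inj₂ (x∈p∧x∉q⇒x∈p─q x∈ x∉A)
  later : ∀ {x} → x ∈ r ─ A zero → ∃[ i ] x ∈ A (suc i)
  later x∈ with cover (p─q⊆p r (A zero) x∈)
  ... | zero  , x∈A = contradiction x∈A (x∈p─q⇒x∉q r (A zero) x∈)
  ... | suc i , x∈A = i , x∈A

sum-disjoint : ∀ {n k} (a : Fin k → ℕ) (A : Fin k → Subset n) (r : Subset n) →
               (∀ i → a i ≤ ∣ A i ∣) → (∀ i → A i ⊆ r) →
               (∀ {i j x} → x ∈ A i → x ∈ A j → i ≡ j) →
               sum (tabulate a) ≤ ∣ r ∣
sum-disjoint {k = 0} a A r a≤A A⊆r disj = z≤n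
sum-disjoint {k = suc k} a A r a≤A A⊆r disj =
  ≤-trans (+-mono-≤ (a≤A zero)
             (sum-disjoint (a ∘ suc) (A ∘ suc) (r ─ A zero) (a≤A ∘ suc)
                (λ i x∈ → x∈p∧x∉q⇒x∈p─q (A⊆r (suc i) x∈) (λ x∈₀ → 0≢1+n (disj x∈₀ x∈)))
                (λ x∈ y∈ → suc-injective (disj x∈ y∈))))
          (∣∣-disjoint (A⊆r zero) (p─q⊆p r (A zero)) (λ x∈ x∈─ → x∈p─q⇒x∉q r (A zero) x∈─ x∈))

∣p-x∣≡∣p∣∸1 : ∀ {n} {p : Subset n} {x} → x ∈ p → ∣ p - x ∣ ≡ ∣ p ∣ ∸ 1
∣p-x∣≡∣p∣∸1 {p = p} {x} x∈p = cong (_∸ 1) (sym (≤-antisym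
  (≤-trans (∣∣-cover {p = ⁅ x ⁆} {p - x} split)
           (≤-reflexive (cong (_+ ∣ p - x ∣) (∣⁅x⁆∣≡1 x))))
  (x∈p⇒∣p-x∣<∣p∣ x∈p)))
  where
  split : ∀ {y} → y ∈ p → y ∈ ⁅ x ⁆ ⊎ y ∈ p - x
  split {y} y∈ with y ≟ x
  ... | yes refl = inj₁ (x∈⁅x⁆ x)
  ... | no  y≢x  = inj₂ (x∈p∧x≢y⇒x∈p-y y∈ y≢x)

x∈p-y⇒x≢y : ∀ {n} {p : Subset n} {x y} → x ∈ p - y → x ≢ y
x∈p-y⇒x≢y {p = p} {y = y} x∈ refl = x∈p─q⇒x∉q p ⁅ y ⁆ x∈ (x∈⁅x⁆ y)

lookup-injective : ∀ {A : Set} {xs : List A} → Unique xs →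
                   ∀ {i j} → lookup xs i ≡ lookup xs j → i ≡ j
lookup-injective (_ AllPairs.∷ _) {zero} {zero} _ = refl
lookup-injective (x∉ AllPairs.∷ _) {zero} {suc j} eq = contradiction eq (All.lookup x∉ (∈-lookup j))
lookup-injective (x∉ AllPairs.∷ _) {suc i} {zero} eq = contradiction (sym eq) (All.lookup x∉ (∈-lookup i))
lookup-injective (_ AllPairs.∷ u) {suc i} {suc j} eq = cong suc (lookup-injective u eq)

-- The partition into the fibres of an idempotent map

module _ {n : ℕ} (c : Fin n → Fin n) (idem : ∀ v → c (c v) ≡ c v) where

  private
    isFixed? : Decidable (λ v → c v ≡ v)
    isFixed? v = c v ≟ v

    fixed : List (Fin n)
    fixed = filter isFixed? (allFin n)

    inFibre? : ∀ i → Decidable (λ v → c v ≡ lookup fixed i)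
    inFibre? i v = c v ≟ lookup fixed i

    lookup-fixed : ∀ i → c (lookup fixed i) ≡ lookup fixed i
    lookup-fixed i = proj₂ (∈-filter⁻ isFixed? {xs = allFin n} (∈-lookup i))

  -- Each non-empty fibre of an idempotent map contains exactly one fixed point, the common value on
  -- it, so the fixed points index the parts. Their list has no repetitions, which makes the index
  -- of a vertex unique.
  fibrePartition : Partition n
  fibrePartition = record
    { size     = length fixed
    ; part     = λ i → subset (inFibre? i)
    ; nonempty = λ i → lookup fixed i , ∈-subset⁺ (inFibre? i) (lookup-fixed i)
    ; covers   = λ v → let cv∈ = ∈-filter⁺ isFixed? (∈-allFin (c v)) (idem v) in
        Any.index cv∈ , ∈-subset⁺ (inFibre? _) (lookup-index cv∈) ,
        λ {i} v∈ → lookup-injective (filter⁺ isFixed? (allFin⁺ n))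
                     (trans (sym (lookup-index cv∈)) (∈-subset⁻ (inFibre? i) v∈))
    }

  open Partition fibrePartition

  centre : Fin size → Fin n
  centre = lookup fixed

  centre-fixed : ∀ i → c (centre i) ≡ centre i
  centre-fixed = lookup-fixed

  ∈-fibre⁺ : ∀ {i v} → c v ≡ centre i → v ∈ part i
  ∈-fibre⁺ {i} = ∈-subset⁺ (inFibre? i)

  ∈-fibre⁻ : ∀ {i v} → v ∈ part i → c v ≡ centre i
  ∈-fibre⁻ {i} = ∈-subset⁻ (inFibre? i)

  -- A part of order `k` has `k - 1` vertices besides its centre, and exactly these are moved by
  -- `c`; the weight therefore counts moved vertices.
  weight-fibrePartition : (r : Subset n) → (∀ {v} → c v ≢ v → v ∈ r) →
                          weight fibrePartition ≤ ∣ r ∣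
  weight-fibrePartition r moved∈r =
    sum-disjoint _ (λ i → part i - centre i) r
      (λ i → ≤-reflexive (sym (∣p-x∣≡∣p∣∸1 (∈-fibre⁺ (centre-fixed i)))))
      (λ i v∈ → moved∈r (λ cv≡v → x∈p-y⇒x≢y {p = part i} v∈
                  (trans (sym cv≡v) (∈-fibre⁻ (p─q⊆p (part i) _ v∈)))))
      (λ {i} {j} {v} v∈i v∈j → let (_ , _ , uniq) = covers v in
         trans (sym (uniq (p─q⊆p (part i) _ v∈i))) (uniq (p─q⊆p (part j) _ v∈j)))

-- Paths and colourings

module _ {n : ℕ} (T : Graph n) where

  open Graph T renaming (sym to adj-sym; irrefl to adj-irrefl)

  -- The list holds all vertices of the path, both ends included and without repetition, so that
  -- `lookup` turns it into the function that `IsCycle` expects.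
  data Path : Fin n → Fin n → List (Fin n) → Set where
    trivial : ∀ {v} → Path v v (v ∷ [])
    step    : ∀ {u v w xs} → Adj u v → u ∉ₗ xs → Path v w xs → Path u w (u ∷ xs)

  path-head : ∀ {u w x xs} → Path u w (x ∷ xs) → x ≡ u
  path-head trivial      = refl
  path-head (step _ _ _) = refl

  path-last : ∀ {u w x xs} → Path u w (x ∷ xs) → lookup (x ∷ xs) (fromℕ (length xs)) ≡ w
  path-last trivial                            = refl
  path-last (step {xs = _ ∷ _} _ _ p)          = path-last p

  path-adj : ∀ {u w x xs} → Path u w (x ∷ xs) →
             ∀ i → Adj (lookup (x ∷ xs) (inject₁ i)) (lookup xs i)
  path-adj (step {u} {xs = _ ∷ _} uv _ p) zero    = subst (Adj u) (sym (path-head p)) uv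
  path-adj (step {xs = _ ∷ _} _ _ p)      (suc i) = path-adj p i

  path-injective : ∀ {u w xs} → Path u w xs → ∀ {i j} → lookup xs i ≡ lookup xs j → i ≡ j
  path-injective trivial {zero} {zero} _ = refl
  path-injective (step _ u∉ p) {zero}  {zero}  _  = refl
  path-injective (step _ u∉ p) {zero}  {suc j} eq = contradiction (subst (_∈ₗ _) (sym eq) (∈-lookup j)) u∉
  path-injective (step _ u∉ p) {suc i} {zero}  eq = contradiction (subst (_∈ₗ _) eq (∈-lookup i)) u∉
  path-injective (step _ u∉ p) {suc i} {suc j} eq = cong suc (path-injective p eq)

  path-suffix : ∀ {u v w xs} → Path v w xs → u ∈ₗ xs →
                ∃[ ys ] (Path u w ys × (∀ {x} → x ∈ₗ ys → x ∈ₗ xs))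
  path-suffix trivial        (here refl) = _ , trivial , id
  path-suffix p@(step _ _ _) (here refl) = _ , p , id
  path-suffix (step _ _ p)   (there u∈)  =
    let (ys , q , sub) = path-suffix p u∈ in ys , q , there ∘ sub

  AdjIn : List (Fin n) → Fin n → Fin n → Set
  AdjIn A u v = u ∈ₗ A × v ∈ₗ A × Adj u v

  -- Loops are cut off from the rear: if `u` recurs on the path already found from the next vertex,
  -- only the part of that path from `u` on is kept.
  walk⇒path : ∀ {A u w} → u ∈ₗ A → Star (AdjIn A) u w →
              ∃[ xs ] (Path u w xs × (∀ {x} → x ∈ₗ xs → x ∈ₗ A))
  walk⇒path u∈ ε = _ , trivial , λ { (here refl) → u∈ }
  walk⇒path {u = u} u∈ ((_ , v∈ , uv) ◅ walk) with walk⇒path v∈ walk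
  ... | xs , p , sub with member? _≟_ u xs
  ...   | yes u∈xs = let (ys , q , sub′) = path-suffix p u∈xs in ys , q , sub ∘ sub′
  ...   | no  u∉xs = u ∷ xs , step uv u∉xs p , λ { (here refl) → u∈ ; (there x∈) → sub x∈ }

  module _ (acyclic : Acyclic T) where

    no-closed-path : ∀ {u w x y z xs} → Path u w (x ∷ y ∷ z ∷ xs) → ¬ Adj w u
    no-closed-path {x = x} {y} {z} {xs} p wu =
      acyclic (lookup (x ∷ y ∷ z ∷ xs)) (path-injective p , path-adj p , closing)
      where
      closing : Adj (lookup (x ∷ y ∷ z ∷ xs) (fromℕ (2 + length xs))) x
      closing rewrite path-last p | path-head p = wu

    no-triangle : ∀ {a b c} → Adj a b → Adj b c → ¬ Adj a c
    no-triangle ab bc ac = no-closed-path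
      (step ab (λ { (here refl) → adj-irrefl ab ; (there (here refl)) → adj-irrefl ac })
         (step bc (λ { (here refl) → adj-irrefl bc }) trivial))
      (adj-sym ac)

    one-neighbour : ∀ {A u v w} → v ∉ₗ A → u ∈ₗ A → Star (AdjIn A) u w →
                    Adj u v → Adj w v → u ≡ w
    one-neighbour v∉ u∈ walk uv wv with walk⇒path u∈ walk
    ... | _ , trivial , _ = refl
    -- `v` is put in front of the path, which avoids it by staying inside `A`. The two clauses only
    -- expose enough of the list to show three vertices.
    ... | _ , p@(step _ _ trivial)      , sub = contradiction wv (no-closed-path (step (adj-sym uv) (v∉ ∘ sub) p))
    ... | _ , p@(step _ _ (step _ _ _)) , sub = contradiction wv (no-closed-path (step (adj-sym uv) (v∉ ∘ sub) p))

    module _ (s : Fin n → Fin n → Bool) (s-sym : ∀ u v → s u v ≡ s v u) where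

      -- The sign `s u v` tells whether the colour changes along the edge `uv`. The walks stay
      -- inside `A`, so that a path made from one cannot meet a vertex yet to be coloured; outside
      -- `A` the colour is arbitrary.
      record Coloured (A : List (Fin n)) : Set where
        field
          walks   : ∀ {u w} → u ∈ₗ A → w ∈ₗ A → Star (AdjIn A) u w
          colour  : Fin n → Bool
          correct : ∀ {u v} → u ∈ₗ A → v ∈ₗ A → Adj u v → colour v ≡ s u v xor colour u

      private
        xor-flip : ∀ a {b d} → b ≡ a xor d → d ≡ a xor b
        xor-flip false refl = refl
        xor-flip true {d = false} refl = refl
        xor-flip true {d = true}  refl = refl

      -- The new vertex has only one neighbour among the coloured ones: a path
      -- between two such neighbours would close up to a cycle.
      extend : ∀ {A u v} → Coloured A → u ∈ₗ A → Adj u v → v ∉ₗ A → Coloured (v ∷ A)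
      extend {A} {u} {v} K u∈ uv v∉ = record
        { walks   = walks′
        ; colour  = colour′
        ; correct = correct′
        }
        where
        open Coloured K
        lift : ∀ {x y} → Star (AdjIn A) x y → Star (AdjIn (v ∷ A)) x y
        lift = Star.map λ { (x∈ , y∈ , xy) → there x∈ , there y∈ , xy }
        uv′ : AdjIn (v ∷ A) u v
        uv′ = there u∈ , here refl , uv
        vu′ : AdjIn (v ∷ A) v u
        vu′ = here refl , there u∈ , adj-sym uv
        walks′ : ∀ {x y} → x ∈ₗ v ∷ A → y ∈ₗ v ∷ A → Star (AdjIn (v ∷ A)) x y
        walks′ (here refl) (here refl) = ε
        walks′ (here refl) (there y∈)  = vu′ ◅ lift (walks u∈ y∈)
        walks′ (there x∈)  (here refl) = lift (walks x∈ u∈) ◅◅ (uv′ ◅ ε)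
        walks′ (there x∈)  (there y∈)  = lift (walks x∈ y∈)
        colour′ : Fin n → Bool
        colour′ x = if does (x ≟ v) then s u v xor colour u else colour x
        new : colour′ v ≡ s u v xor colour u
        new rewrite dec-true (v ≟ v) refl = refl
        old : ∀ {x} → x ∈ₗ A → colour′ x ≡ colour x
        old {x} x∈ rewrite dec-false (x ≟ v) (λ { refl → v∉ x∈ }) = refl
        new-edge : ∀ {x} → x ∈ₗ A → Adj x v → colour′ v ≡ s x v xor colour′ x
        new-edge x∈ xv with one-neighbour v∉ u∈ (walks u∈ x∈) uv xv
        ... | refl = trans new (cong (s u v xor_) (sym (old u∈)))
        correct′ : ∀ {x y} → x ∈ₗ v ∷ A → y ∈ₗ v ∷ A → Adj x y → colour′ y ≡ s x y xor colour′ x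
        correct′ (here refl) (here refl) xy = contradiction xy adj-irrefl
        correct′ {y = y} (here refl) (there y∈) xy rewrite s-sym v y =
          xor-flip (s y v) (new-edge y∈ (adj-sym xy))
        correct′ (there x∈) (here refl) xy = new-edge x∈ xy
        correct′ {x} {y} (there x∈) (there y∈) xy =
          trans (old y∈) (trans (correct x∈ y∈ xy) (cong (s x y xor_) (sym (old x∈))))

      reach : ∀ {A u v} → Coloured A → u ∈ₗ A → Star Adj u v →
              ∃[ B ] (Coloured B × (∀ {x} → x ∈ₗ A → x ∈ₗ B) × v ∈ₗ B)
      reach K u∈ ε = _ , K , id , u∈
      reach {A} K u∈ (_◅_ {j = w} uw walk) with member? _≟_ w A
      ... | yes w∈ = reach K w∈ walk
      ... | no  w∉ = let (B , K′ , sub , v∈) = reach (extend K u∈ uw w∉) (here refl) walk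
                     in B , K′ , sub ∘ there , v∈

      -- A tree has no cycle around which the prescribed changes would have to be consistent, so the
      -- coloured set can grow from `r` to every vertex.
      signed-colouring : Connected T → Fin n →
        ∃[ colour ] (∀ {u v} → Adj u v → colour v ≡ s u v xor colour u)
      signed-colouring connected r =
        let (A , K , all∈ , _) = reach-all (allFin n)
        in Coloured.colour K ,
           λ {u} {v} → Coloured.correct K (all∈ (∈-allFin u)) (all∈ (∈-allFin v))
        where
        start : Coloured (r ∷ [])
        start = record
          { walks   = λ { (here refl) (here refl) → ε }
          ; colour  = λ _ → true
          ; correct = λ { (here refl) (here refl) rr → contradiction rr adj-irrefl }
          }
        reach-all : (xs : List (Fin n)) →
          ∃[ A ] (Coloured A × (∀ {x} → x ∈ₗ xs → x ∈ₗ A) × r ∈ₗ A)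
        reach-all []       = r ∷ [] , start , (λ ()) , here refl
        reach-all (x ∷ xs) =
          let (A , K , sub , r∈) = reach-all xs
              (B , K′ , sub′ , x∈) = reach K r∈ (connected r x)
          in B , K′ , (λ { (here refl) → x∈ ; (there y∈) → sub′ (sub y∈) }) , sub′ r∈

    -- An edge between `x` and `p x` gets the sign `false`, every other edge `true`. A vertex with
    -- `p x ≡ x` marks no edge, as there are no loops.
    colouring : Connected T → Fin n → (p : Fin n → Fin n) →
      ∃[ colour ] ((∀ {x} → Adj x (p x) → colour (p x) ≡ colour x)
                 × (∀ {u v} → Adj u v → p u ≢ v → p v ≢ u → colour v ≡ not (colour u)))
    colouring connected r p =
      let (colour , correct) = signed-colouring s s-sym connected r
      in colour , (λ {x} xp → trans (correct xp) (cong (_xor colour x) (same x)))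
                , (λ {u} uv pu≢v pv≢u → trans (correct uv) (cong (_xor colour u) (differ pu≢v pv≢u)))
      where
      s : Fin n → Fin n → Bool
      s u v = not (does (p u ≟ v) ∨ does (p v ≟ u))
      s-sym : ∀ u v → s u v ≡ s v u
      s-sym u v = cong not (∨-comm (does (p u ≟ v)) _)
      same : ∀ x → s x (p x) ≡ false
      same x rewrite dec-true (p x ≟ p x) refl = refl
      differ : ∀ {u v} → p u ≢ v → p v ≢ u → s u v ≡ true
      differ {u} {v} pu≢v pv≢u
        rewrite dec-false (p u ≟ v) pu≢v | dec-false (p v ≟ u) pv≢u = refl

-- From star partitionings to swap sets

module _ {n : ℕ} (T : Graph n) where

  open Graph T renaming (sym to adj-sym; irrefl to adj-irrefl)

  Covered : (Fin n → Fin n) → Fin n → Set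
  Covered c v = ∃[ w ] (w ≢ v × c w ≡ c v)

  covered? : ∀ c → Decidable (Covered c)
  covered? c v = any? λ w → ¬? (w ≟ v) ×-dec (c w ≟ c v)

  Excess : (Fin n → Fin n) → Fin n → Set
  Excess c v = c v ≢ v × ∃[ w ] (w ≢ v × w ≢ c v × c w ≡ c v)

  excess? : ∀ c → Decidable (Excess c)
  excess? c v = ¬? (c v ≟ v) ×-dec any? λ w → ¬? (w ≟ v) ×-dec ¬? (w ≟ c v) ×-dec (c w ≟ c v)

  moved? : (c : Fin n → Fin n) → Decidable (λ v → c v ≢ v)
  moved? c v = ¬? (c v ≟ v)

  moved : (Fin n → Fin n) → Subset n
  moved c = subset (moved? c)

  -- c sends every vertex to the centre of its star, so Covered c v says that
  -- the part of v is not K₁, and Excess c v that v is an end of a star with at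
  -- least three vertices.
  record StarMap (c : Fin n → Fin n) : Set where
    field
      idem     : ∀ v → c (c v) ≡ c v
      adjacent : ∀ {v} → c v ≢ v → Adj v (c v)
      isolated : ∀ {x} → ¬ Covered c x →
                 ∃[ a ] ∃[ b ] (a ≢ b × Adj x a × Adj x b × Covered c a × Covered c b)
      escape   : ∀ {v} → Excess c v → ∃[ y ] (y ≢ c v × Adj v y)

  -- Remove the end v from its star. It becomes a K₁ part if u ≡ v, and forms a
  -- K₂ part with the former K₁ part u otherwise.
  module Detach {c : Fin n → Fin n} (S : StarMap c) {u v : Fin n} (ex : Excess c v)
                (h : u ≢ v → ¬ Covered c u × Adj v u) where

    open StarMap S

    cv≢v : c v ≢ v
    cv≢v = proj₁ ex

    spare : ∃[ w ] (w ≢ v × w ≢ c v × c w ≡ c v)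
    spare = proj₂ ex

    role : u ≡ v ⊎ (¬ Covered c u × Adj v u)
    role with u ≟ v
    ... | yes u≡v = inj₁ u≡v
    ... | no u≢v  = inj₂ (h u≢v)

    -- `v` becomes the centre of its new part in both cases; if `u ≡ v`, the second clause is never
    -- reached.
    detach : Fin n → Fin n
    detach x with x ≟ v | x ≟ u
    ... | yes _ | _     = v
    ... | no  _ | yes _ = v
    ... | no  _ | no  _ = c x

    detach-v : detach v ≡ v
    detach-v with v ≟ v | v ≟ u
    ... | yes _  | _ = refl
    ... | no v≢v | _ = contradiction refl v≢v

    detach-u : detach u ≡ v
    detach-u with u ≟ v | u ≟ u
    ... | yes _ | _      = refl
    ... | no _  | yes _  = refl
    ... | no _  | no u≢u = contradiction refl u≢u

    detach-other : ∀ {x} → x ≢ v → x ≢ u → detach x ≡ c x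
    detach-other {x} x≢v x≢u with x ≟ v | x ≟ u
    ... | yes x≡v | _       = contradiction x≡v x≢v
    ... | no _    | yes x≡u = contradiction x≡u x≢u
    ... | no _    | no _    = refl

    data Position (x : Fin n) : Set where
      at-v  : x ≡ v → Position x
      at-u  : x ≡ u → x ≢ v → ¬ Covered c u → Adj v u → Position x
      other : x ≢ v → x ≢ u → Position x

    position : ∀ x → Position x
    position x with x ≟ v | x ≟ u | role
    ... | yes x≡v | _        | _              = at-v x≡v
    ... | no x≢v  | yes refl | inj₁ u≡v       = contradiction u≡v x≢v
    ... | no x≢v  | yes x≡u  | inj₂ (¬cu , vu) = at-u x≡u x≢v ¬cu vu
    ... | no x≢v  | no x≢u   | _              = other x≢v x≢u

    c≢v : ∀ x → c x ≢ v
    c≢v x cx≡v = cv≢v (trans (cong c (sym cx≡v)) (trans (idem x) cx≡v))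

    c≢u : ∀ {x} → x ≢ u → c x ≢ u
    c≢u {x} x≢u cx≡u with role
    ... | inj₁ refl      = c≢v x cx≡u
    ... | inj₂ (¬cu , _) = ¬cu (x , x≢u , trans (sym (idem x)) (cong c cx≡u))

    -- Apart from the K₁ part `u`, only `v` leaves a part, so only a witness `v` has to be replaced.
    -- If `z` is another end of that star, the centre `c v` takes over; if `z` is the centre, the
    -- end in `spare` does. This is where the star needs three vertices.
    covered-mono : ∀ {z} → z ≢ v → Covered c z → Covered detach z
    covered-mono {z} z≢v (w , w≢z , cw≡cz) with position z
    ... | at-v z≡v = contradiction z≡v z≢v
    ... | at-u refl z≢v ¬cu _ = contradiction (w , w≢z , cw≡cz) ¬cu
    ... | other _ z≢u with position w
    ...   | other w≢v w≢u = w , w≢z , trans (detach-other w≢v w≢u) (trans cw≡cz (sym (detach-other z≢v z≢u)))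
    ...   | at-u refl _ ¬cu _ = contradiction (z , z≢u , sym cw≡cz) ¬cu
    ...   | at-v refl with z ≟ c v | spare
    ...     | no z≢cv | _ = c v , ≢-sym z≢cv ,
              trans (detach-other (c≢v v) cv≢u) (trans (idem v) (trans cw≡cz (sym (detach-other z≢v z≢u))))
              where
              cv≢u : c v ≢ u
              cv≢u with role
              ... | inj₁ refl      = cv≢v
              ... | inj₂ (¬cu , _) = λ cv≡u → ¬cu (v , (λ v≡u → cv≢v (trans cv≡u (sym v≡u))) , trans (sym (idem v)) (cong c cv≡u))
    ...     | yes refl | t , t≢v , t≢cv , ct≡cv =
              t , t≢cv , trans (detach-other t≢v t≢u) (trans ct≡cv (trans cw≡cz (sym (detach-other z≢v z≢u))))
              where
              t≢u : t ≢ u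
              t≢u refl with role
              ... | inj₁ u≡v       = t≢v u≡v
              ... | inj₂ (¬cu , _) = ¬cu (v , ≢-sym t≢v , sym ct≡cv)

    detach-idem : ∀ x → detach (detach x) ≡ detach x
    detach-idem x with position x
    ... | at-v refl = cong detach detach-v
    ... | at-u refl _ _ _ = trans (cong detach detach-u) (trans detach-v (sym detach-u))
    ... | other x≢v x≢u = trans (cong detach (detach-other x≢v x≢u))
            (trans (detach-other (c≢v x) (c≢u x≢u)) (trans (idem x) (sym (detach-other x≢v x≢u))))

    detach-adjacent : ∀ {x} → detach x ≢ x → Adj x (detach x)
    detach-adjacent {x} dx≢x with position x
    ... | at-v refl = contradiction detach-v dx≢x
    ... | at-u refl _ _ vu = subst (Adj u) (sym detach-u) (adj-sym vu)
    ... | other x≢v x≢u = subst (Adj x) (sym (detach-other x≢v x≢u))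
            (adjacent (dx≢x ∘ trans (detach-other x≢v x≢u)))

    -- `v` is now a centre, with at most `u` as companion, and every other vertex keeps its value
    -- under `c`. Hence no excess is created, and that of `v` disappears.
    detach-excess : ∀ {z} → Excess detach z → Excess c z × z ≢ v × detach z ≡ c z
    detach-excess {z} (dz≢z , w , w≢z , w≢dz , dw≡dz) with position z
    ... | at-v refl = contradiction detach-v dz≢z
    ... | at-u refl _ _ _ with position w
    ...   | at-v refl = contradiction (sym detach-u) w≢dz
    ...   | at-u w≡u _ _ _ = contradiction w≡u w≢z
    ...   | other w≢v w≢u = contradiction (trans (sym (detach-other w≢v w≢u)) (trans dw≡dz detach-u)) (c≢v w)
    detach-excess {z} (dz≢z , w , w≢z , w≢dz , dw≡dz) | other z≢v z≢u with position w
    ...   | at-v refl = contradiction (trans (sym (detach-other z≢v z≢u)) (trans (sym dw≡dz) detach-v)) (c≢v z)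
    ...   | at-u refl _ _ _ = contradiction (trans (sym (detach-other z≢v z≢u)) (trans (sym dw≡dz) detach-u)) (c≢v z)
    ...   | other w≢v w≢u =
            (dz≢z ∘ trans dz , w , w≢z , w≢dz ∘ (λ w≡cz → trans w≡cz (sym dz)) ,
              trans (sym (detach-other w≢v w≢u)) (trans dw≡dz dz)) , z≢v , dz
            where
            dz : detach z ≡ c z
            dz = detach-other z≢v z≢u

    -- `v` is no longer moved, and only `u` can be newly moved; so `g` replaces `u` by `v`.
    moved-detach : ∣ moved detach ∣ ≤ ∣ moved c ∣
    moved-detach = ∣∣-injection (moved detach) (moved c) g
      (λ x∈ → ∈-subset⁺ (moved? c) (g-moved (∈-subset⁻ (moved? detach) x∈)))
      (λ x∈ y∈ → g-injective (∈-subset⁻ (moved? detach) x∈) (∈-subset⁻ (moved? detach) y∈))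
      where
      g : Fin n → Fin n
      g x with x ≟ u
      ... | yes _ = v
      ... | no  _ = x
      g-view : ∀ x → (x ≡ u × g x ≡ v) ⊎ (x ≢ u × g x ≡ x)
      g-view x with x ≟ u
      ... | yes x≡u = inj₁ (x≡u , refl)
      ... | no  x≢u = inj₂ (x≢u , refl)
      g-moved : ∀ {x} → detach x ≢ x → c (g x) ≢ g x
      g-moved {x} dx≢x with g-view x
      ... | inj₁ (_ , gx≡v)   rewrite gx≡v = cv≢v
      ... | inj₂ (x≢u , gx≡x) rewrite gx≡x =
        λ cx≡x → dx≢x (trans (detach-other (λ { refl → dx≢x detach-v }) x≢u) cx≡x)
      g-injective : ∀ {x y} → detach x ≢ x → detach y ≢ y → g x ≡ g y → x ≡ y
      g-injective {x} {y} dx≢x dy≢y gx≡gy with g-view x | g-view y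
      ... | inj₁ (x≡u , _) | inj₁ (y≡u , _) = trans x≡u (sym y≡u)
      ... | inj₁ (_ , gx≡v) | inj₂ (_ , gy≡y) with trans (sym gx≡v) (trans gx≡gy gy≡y)
      ...   | refl = contradiction detach-v dy≢y
      g-injective {x} {y} dx≢x dy≢y gx≡gy | inj₂ (_ , gx≡x) | inj₁ (_ , gy≡v)
        with trans (sym gx≡x) (trans gx≡gy gy≡v)
      ...   | refl = contradiction detach-v dx≢x
      g-injective {x} {y} dx≢x dy≢y gx≡gy | inj₂ (_ , gx≡x) | inj₂ (_ , gy≡y) =
        trans (sym gx≡x) (trans gx≡gy gy≡y)

    -- If `v` becomes a K₁ part, its neighbours have to be covered for two reasons: the neighbour
    -- from `escape` must serve in `isolated`, and no other K₁ part may have relied on `v`.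
    starMap : (u ≡ v → ∀ {y} → Adj v y → Covered c y) → StarMap detach
    starMap neighbours-covered = record
      { idem     = detach-idem
      ; adjacent = detach-adjacent
      ; isolated = isolated′
      ; escape   = λ ex′ → let (exc , _ , dz≡cz) = detach-excess ex′
                               (y , y≢cz , zy) = escape exc
                           in y , y≢cz ∘ (λ y≡dz → trans y≡dz dz≡cz) , zy
      }
      where
      isolated′ : ∀ {x} → ¬ Covered detach x →
        ∃[ a ] ∃[ b ] (a ≢ b × Adj x a × Adj x b × Covered detach a × Covered detach b)
      isolated′ {x} ¬cx with position x | u ≟ v
      ... | at-v refl | no u≢v = contradiction (u , u≢v , trans detach-u (sym detach-v)) ¬cx
      ... | at-v refl | yes u≡v =
        -- The new K₁ part `v` is adjacent to its former centre, whose star keeps at least two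
        -- vertices, and to the neighbour supplied by `escape`.
        let (y , y≢cv , vy) = escape ex in
        c v , y , ≢-sym y≢cv , adjacent cv≢v , vy ,
        covered-mono cv≢v (v , ≢-sym cv≢v , sym (idem v)) ,
        covered-mono (λ y≡v → adj-irrefl (subst (Adj v) y≡v vy)) (neighbours-covered u≡v vy)
      ... | at-u refl u≢v _ _ | _ = contradiction (v , ≢-sym u≢v , trans detach-v (sym detach-u)) ¬cx
      ... | other x≢v x≢u | dec =
        let (a , b , a≢b , xa , xb , ca , cb) = isolated (¬cx ∘ covered-mono x≢v) in
        a , b , a≢b , xa , xb , lift xa ca (a ≟ v) dec , lift xb cb (b ≟ v) dec
        where
        lift : ∀ {a} → Adj x a → Covered c a → Dec (a ≡ v) → Dec (u ≡ v) → Covered detach a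
        lift xa ca (no a≢v)   _        = covered-mono a≢v ca
        lift xa ca (yes refl) (no u≢v) = u , u≢v , trans detach-u (sym detach-v)
        -- Here `v` has just become a K₁ part, but then its neighbour `x` was covered by assumption
        -- and has stayed so.
        lift xa ca (yes refl) (yes u≡v) =
          contradiction (covered-mono x≢v (neighbours-covered u≡v (adj-sym xa))) ¬cx

  -- Reduction to stars with at most two vertices

  Reduction : (c : Fin n → Fin n) → (Fin n → Set) → Set
  Reduction c P = ∃[ c′ ] (StarMap c′ × (∀ {z} → Excess c′ z → Excess c z × P z) × ∣ moved c′ ∣ ≤ ∣ moved c ∣)

  -- The vertex `u` is a K₁ neighbour of `v` if there is one, and `v` itself otherwise; in the
  -- second case all neighbours of `v` are covered, as `starMap` requires. Since no excess arises
  -- anew, the vertices can be treated one after another.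
  reduce : ∀ {c} → StarMap c → ∀ v → Reduction c (_≢ v)
  reduce {c} S v with excess? c v
  ... | no ¬ex = c , S , (λ ex → ex , λ { refl → ¬ex ex }) , ℕ.≤-refl
  ... | yes ex with any? (λ u → adj? v u ×-dec ¬? (covered? c u))
  ...   | yes (u , vu , ¬cu) = D.detach , D.starMap (λ { refl → contradiction vu adj-irrefl }) ,
            (λ ex′ → let (e , z≢v , _) = D.detach-excess ex′ in e , z≢v) , D.moved-detach
          where module D = Detach S ex (λ _ → ¬cu , vu)
  ...   | no none = D.detach , D.starMap (λ _ → neighbours-covered) ,
            (λ ex′ → let (e , z≢v , _) = D.detach-excess ex′ in e , z≢v) , D.moved-detach
          where
          module D = Detach S ex (λ v≢v → contradiction refl v≢v)
          neighbours-covered : ∀ {y} → Adj v y → Covered c y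
          neighbours-covered {y} vy with covered? c y
          ... | yes cy = cy
          ... | no ¬cy = contradiction (y , vy , ¬cy) none

  reduce-all : ∀ {c} → StarMap c → (xs : List (Fin n)) → Reduction c (_∉ₗ xs)
  reduce-all {c} S [] = c , S , (λ ex → ex , λ ()) , ℕ.≤-refl
  reduce-all S (x ∷ xs) =
    let (c₁ , S₁ , ex₁ , le₁) = reduce-all S xs
        (c₂ , S₂ , ex₂ , le₂) = reduce S₁ x
    in c₂ , S₂ ,
       (λ ex → let (e , z≢x) = ex₂ ex ; (e′ , z∉xs) = ex₁ e
               in e′ , λ { (here z≡x) → z≢x z≡x ; (there z∈) → z∉xs z∈ }) ,
       ≤-trans le₂ le₁

  no-excess : ∀ {c} → StarMap c → ∃[ c′ ] (StarMap c′ × (∀ {z} → ¬ Excess c′ z) × ∣ moved c′ ∣ ≤ ∣ moved c ∣)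
  no-excess S =
    let (c′ , S′ , ex , le) = reduce-all S (allFin n)
    in c′ , S′ , (λ {z} e → proj₂ (ex e) (∈-allFin z)) , le

  -- The two sides of the remaining matching

  perfectMatching : ∀ {D D′ : Subset n} (m : Fin n → Fin n) → (∀ v → m (m v) ≡ v) →
    (∀ {v} → v ∈ D → m v ∈ D′) → (∀ {v} → v ∈ D′ → m v ∈ D) →
    (∀ {v} → v ∈ D → Adj v (m v)) → PerfectMatching T D D′
  perfectMatching {D} {D′} m m-inv into back adj =
    ↔⇒⤖ (mk↔ₛ′ (λ (v , v∈) → m v , into v∈) (λ (v , v∈) → m v , back v∈)
           (λ (v , _) → pair≡ D′ (m-inv v)) (λ (v , _) → pair≡ D (m-inv v))) ,
    λ (v , v∈) → adj v∈
    where
    pair≡ : ∀ (p : Subset n) {x y} {x∈ : x ∈ p} {y∈ : y ∈ p} → x ≡ y → (x , x∈) ≡ (y , y∈)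
    pair≡ p {x} {x∈ = x∈} {y∈} refl = cong (x ,_) ([]=-irrelevant x∈ y∈)

  module _ (tree : IsTree T) (r : Fin n) {c : Fin n → Fin n} (S : StarMap c)
           (none : ∀ {z} → ¬ Excess c z) where

    open StarMap S

    private
      -- With two partners the part would have three vertices, one of them an excess end: `w` if `v`
      -- is the centre, and `v` otherwise.
      partner-unique : ∀ {v w w′} → w ≢ v → w′ ≢ v → c w ≡ c v → c w′ ≡ c v → w ≡ w′
      partner-unique {v} {w} {w′} w≢v w′≢v cw cw′ with w ≟ w′ | c v ≟ v
      ... | yes w≡w′ | _ = w≡w′
      ... | no w≢w′ | yes cv≡v = contradiction
        ((λ cw≡w → w≢v (trans (sym cw≡w) (trans cw cv≡v))) , w′ , ≢-sym w≢w′ ,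
         (λ w′≡cw → w′≢v (trans w′≡cw (trans cw cv≡v))) , trans cw′ (sym cw)) none
      ... | no w≢w′ | no cv≢v with w ≟ c v
      ...   | no w≢cv = contradiction (cv≢v , w , w≢v , w≢cv , cw) none
      ...   | yes w≡cv = contradiction (cv≢v , w′ , w′≢v , (λ w′≡cv → w≢w′ (trans w≡cv (sym w′≡cv))) , cw′) none

      m : Fin n → Fin n
      m v with covered? c v
      ... | yes (w , _) = w
      ... | no _        = v

      m-spec : ∀ {v} → Covered c v → m v ≢ v × c (m v) ≡ c v
      m-spec {v} cv with covered? c v
      ... | yes (_ , spec) = spec
      ... | no ¬cv         = contradiction cv ¬cv

      m-covered : ∀ {v} → Covered c v → Covered c (m v)
      m-covered {v} cv = let (mv≢v , cmv) = m-spec cv in v , ≢-sym mv≢v , sym cmv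

      m-uncovered : ∀ {v} → ¬ Covered c v → m v ≡ v
      m-uncovered {v} ¬cv with covered? c v
      ... | yes cv = contradiction cv ¬cv
      ... | no _   = refl

      m-inv : ∀ v → m (m v) ≡ v
      m-inv v with covered? c v
      ... | yes (w , w≢v , cw) = let (mw≢w , cmw) = m-spec {w} (v , ≢-sym w≢v , sym cw) in
                                    partner-unique mw≢w (≢-sym w≢v) cmw (sym cw)
      ... | no ¬cv = m-uncovered ¬cv

      m-adj : ∀ {v} → Covered c v → Adj v (m v)
      m-adj {v} cv with m-spec cv | c v ≟ v
      ... | mv≢v , cmv | yes cv≡v = adj-sym (subst (Adj (m v)) (trans cmv cv≡v)
                                      (adjacent (λ eq → mv≢v (trans (sym eq) (trans cmv cv≡v)))))
      ... | mv≢v , cmv | no cv≢v = subst (Adj v) (partner-unique cv≢v mv≢v (idem v) cmv) (adjacent cv≢v)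

      -- Fixing the covered vertices leaves the matching edges unmarked; only one edge at each
      -- uncovered vertex is exempt from the change of colour.
      p : Fin n → Fin n
      p x with covered? c x
      ... | yes _  = x
      ... | no ¬cx = proj₁ (isolated ¬cx)

      p-covered : ∀ {x} → Covered c x → p x ≡ x
      p-covered {x} cx with covered? c x
      ... | yes _  = refl
      ... | no ¬cx = contradiction cx ¬cx

      p-uncovered : ∀ {x} → ¬ Covered c x →
        Adj x (p x) × Covered c (p x) × ∃[ b ] (p x ≢ b × Adj x b × Covered c b)
      p-uncovered {x} ¬cx with covered? c x
      ... | yes cx = contradiction cx ¬cx
      ... | no ¬cx′ = let (a , b , a≢b , xa , xb , ca , cb) = isolated ¬cx′ in xa , ca , b , a≢b , xb , cb

      colours : ∃[ colour ] ((∀ {x} → Adj x (p x) → colour (p x) ≡ colour x)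
                           × (∀ {u v} → Adj u v → p u ≢ v → p v ≢ u → colour v ≡ not (colour u)))
      colours = colouring T (proj₂ tree) (proj₁ tree) r p

      colour : Fin n → Bool
      colour = proj₁ colours

      colour-m : ∀ {v} → Covered c v → colour (m v) ≡ not (colour v)
      colour-m {v} cv = proj₂ (proj₂ colours) (m-adj cv)
        (λ pv≡mv → proj₁ (m-spec cv) (trans (sym pv≡mv) (p-covered cv)))
        (λ pmv≡v → proj₁ (m-spec cv) (trans (sym (p-covered (m-covered cv))) pmv≡v))

      side? : ∀ d → Decidable (λ v → Covered c v × colour v ≡ d)
      side? d v = covered? c v ×-dec (colour v Bool.≟ d)

      side : Bool → Subset n
      side d = subset (side? d)

      m-side : ∀ {d v} → v ∈ side d → m v ∈ side (not d)
      m-side {d} v∈ = let (cv , colv) = ∈-subset⁻ (side? d) v∈ in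
        ∈-subset⁺ (side? (not d)) (m-covered cv , trans (colour-m cv) (cong not colv))

      m-injective : ∀ {v w} → m v ≡ m w → v ≡ w
      m-injective {v} {w} eq = trans (sym (m-inv v)) (trans (cong m eq) (m-inv w))

      side-size : ∀ d → ∣ side d ∣ ≤ ∣ side (not d) ∣
      side-size d = ∣∣-injection (side d) (side (not d)) m m-side (λ _ _ → m-injective)

      -- A matched vertex of the wrong colour is dominated by its partner. For an unmatched `v`, the
      -- neighbour `p v` has the colour of `v` and the neighbour `b` the opposite one, so `v` is
      -- dominated from both sides.
      dominates : ∀ d → Dominating T (side d)
      dominates d v with covered? c v | colour v Bool.≟ d
      ... | yes cv | yes colv = inj₁ (∈-subset⁺ (side? d) (cv , colv))
      ... | yes cv | no ¬colv = inj₂ (m v ,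
              ∈-subset⁺ (side? d) (m-covered cv , trans (colour-m cv) (sym (¬-not (≢-sym ¬colv)))) ,
              adj-sym (m-adj cv))
      ... | no ¬cv | yes colv = let (va , ca , _) = p-uncovered ¬cv in
              inj₂ (p v , ∈-subset⁺ (side? d) (ca , trans (proj₁ (proj₂ colours) va) colv) , adj-sym va)
      ... | no ¬cv | no ¬colv = let (_ , _ , b , pv≢b , vb , cb) = p-uncovered ¬cv in
              inj₂ (b , ∈-subset⁺ (side? d) (cb ,
                trans (proj₂ (proj₂ colours) vb pv≢b (λ pb≡v → adj-irrefl (subst (Adj v) (trans (sym (p-covered cb)) pb≡v) vb)))
                      (sym (¬-not (≢-sym ¬colv)))) , adj-sym vb)

      -- Each K₂ part has exactly one moved vertex, and `g` selects it from the part of `v`.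
      -- Partners differ in colour, so distinct vertices of `side true` lie in different parts.
      side≤moved : ∣ side true ∣ ≤ ∣ moved c ∣
      side≤moved = ∣∣-injection (side true) (moved c) g
        (λ v∈ → ∈-subset⁺ (moved? c) (g-moved (proj₁ (∈-subset⁻ (side? true) v∈))))
        (λ v∈ w∈ → g-injective (∈-subset⁻ (side? true) v∈) (∈-subset⁻ (side? true) w∈))
        where
        g : Fin n → Fin n
        g v with c v ≟ v
        ... | yes _ = m v
        ... | no _  = v
        g-moved : ∀ {v} → Covered c v → c (g v) ≢ g v
        g-moved {v} cv with c v ≟ v
        ... | yes cv≡v = let (mv≢v , cmv) = m-spec cv in
                         λ eq → mv≢v (trans (sym eq) (trans cmv cv≡v))
        ... | no cv≢v  = cv≢v
        opposite : ∀ {v w} → Covered c v × colour v ≡ true → Covered c w × colour w ≡ true → m v ≢ w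
        opposite (cv , colv) (_ , colw) refl =
          case trans (sym colw) (trans (colour-m cv) (cong not colv)) of λ ()
        g-injective : ∀ {v w} → Covered c v × colour v ≡ true → Covered c w × colour w ≡ true →
                      g v ≡ g w → v ≡ w
        g-injective {v} {w} v∈ w∈ with c v ≟ v | c w ≟ w
        ... | yes _ | yes _ = m-injective
        ... | yes _ | no _  = λ eq → contradiction eq (opposite v∈ w∈)
        ... | no _  | yes _ = λ eq → contradiction (sym eq) (opposite w∈ v∈)
        ... | no _  | no _  = id

    matching⇒swapSet : ∃[ D ] (SwapSet T D × ∣ D ∣ ≤ ∣ moved c ∣)
    matching⇒swapSet =
      side true ,
      (dominates true , side false , dominates false ,
       (λ (v , v∈) → let (v∈t , v∈f) = x∈p∩q⁻ (side true) (side false) v∈ in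
          case trans (sym (proj₂ (∈-subset⁻ (side? true) v∈t))) (proj₂ (∈-subset⁻ (side? false) v∈f)) of λ ()) ,
       ≤-antisym (side-size true) (side-size false) ,
       perfectMatching m m-inv m-side m-side (λ v∈ → m-adj (proj₁ (∈-subset⁻ (side? true) v∈)))) ,
      side≤moved

  -- The star map of a simple star partitioning

  module _ (weak : IsWeak T) {P : Partition n} (simple : IsSimpleStarPartitioning T P) where

    open Partition P
    open IsSimpleStarPartitioning simple renaming (isolated to K₁-neighbours)

    private
      index : Fin n → Fin size
      index v = proj₁ (covers v)

      ∈-index : ∀ v → v ∈ part (index v)
      ∈-index v = proj₁ (proj₂ (covers v))

      index-unique : ∀ {v i} → v ∈ part i → index v ≡ i
      index-unique {v} = proj₂ (proj₂ (covers v))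

      hub : Fin size → Fin n
      hub i = proj₁ (stars i)

      hub∈ : ∀ i → hub i ∈ part i
      hub∈ i = proj₁ (proj₂ (stars i))

      hub-adj : ∀ {i u} → u ∈ part i → u ≢ hub i → Adj (hub i) u
      hub-adj {i} = proj₁ (proj₂ (proj₂ (stars i)))

      c : Fin n → Fin n
      c v = hub (index v)

      index-c : ∀ v → index (c v) ≡ index v
      index-c v = index-unique (hub∈ (index v))

      c-≡ : ∀ {v w} → index v ≡ index w → c v ≡ c w
      c-≡ = cong hub

      index-≡ : ∀ {v w} → c v ≡ c w → index v ≡ index w
      index-≡ {v} {w} eq = trans (sym (index-c v)) (trans (cong index eq) (index-c w))

      uncovered⇒K₁ : ∀ {x} → ¬ Covered c x → ∣ part (index x) ∣ ≡ 1
      uncovered⇒K₁ {x} ¬cx = ≡⇒∣p∣≡1 (∈-index x) alone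
        where
        alone : ∀ {y} → y ∈ part (index x) → y ≡ x
        alone {y} y∈ with y ≟ x
        ... | yes y≡x = y≡x
        ... | no y≢x  = contradiction (y , y≢x , c-≡ (index-unique y∈)) ¬cx

      covered : ∀ {a j} → a ∈ part j → ∣ part j ∣ ≢ 1 → Covered c a
      covered {a} {j} a∈ ≢1 with covered? c a
      ... | yes ca = ca
      ... | no ¬ca = contradiction (subst (λ i → ∣ part i ∣ ≡ 1) (index-unique a∈) (uncovered⇒K₁ ¬ca)) ≢1

      adjacent : ∀ {v} → c v ≢ v → Adj v (c v)
      adjacent {v} cv≢v = adj-sym (hub-adj (∈-index v) (≢-sym cv≢v))

      isolated : ∀ {x} → ¬ Covered c x →
        ∃[ a ] ∃[ b ] (a ≢ b × Adj x a × Adj x b × Covered c a × Covered c b)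
      isolated {x} ¬cx =
        let K₁ = uncovered⇒K₁ ¬cx
            (j , k , j≢k , j≢1 , (x₁ , a , x₁∈ , a∈ , x₁a) , k≢1 , (x₂ , b , x₂∈ , b∈ , x₂b)) =
              K₁-neighbours (index x) K₁
        in a , b ,
           (λ a≡b → j≢k (trans (sym (index-unique a∈)) (trans (cong index a≡b) (index-unique b∈)))) ,
           subst (λ y → Adj y a) (∣p∣≡1⇒x≡y K₁ x₁∈ (∈-index x)) x₁a ,
           subst (λ y → Adj y b) (∣p∣≡1⇒x≡y K₁ x₂∈ (∈-index x)) x₂b ,
           covered a∈ j≢1 , covered b∈ k≢1

      -- An end of a star on at least three vertices is not a leaf of T: in a
      -- weak graph it would be the only leaf at the centre, hence in a K₂ part.
      escape : ∀ {v} → Excess c v → ∃[ y ] (y ≢ c v × Adj v y)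
      escape {v} (cv≢v , w , w≢v , w≢cv , cw≡cv)
        with any? (λ y → ¬? (y ≟ c v) ×-dec adj? v y)
      ... | yes found = found
      ... | no none = contradiction (leafPairs (c v) v (adj-sym (adjacent cv≢v) , leaf , only)) not-pair
        where
        leaf : Leaf T v
        leaf = ≡⇒∣p∣≡1 (∈-subset⁺ (adj? v) (adjacent cv≢v)) λ {y} y∈ → only-c (∈-subset⁻ (adj? v) y∈)
          where
          only-c : ∀ {y} → Adj v y → y ≡ c v
          only-c {y} vy with y ≟ c v
          ... | yes y≡cv = y≡cv
          ... | no y≢cv  = contradiction (y , y≢cv , vy) none
        only : ∀ {l} → Adj (c v) l → Leaf T l → l ≡ v
        only {l} cvl l-leaf with l ≟ v
        ... | yes l≡v = l≡v
        ... | no l≢v  = contradiction (c v , l , v , l≢v , cvl , adj-sym (adjacent cv≢v) , l-leaf , leaf) weak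
        not-pair : ¬ (∃[ i ] part i ≡ ⁅ c v ⁆ ∪ ⁅ v ⁆)
        not-pair (i , eq) =
          [ w≢cv ∘ x∈⁅y⁆⇒x≡y (c v) , w≢v ∘ x∈⁅y⁆⇒x≡y v ]′
            (x∈p∪q⁻ ⁅ c v ⁆ ⁅ v ⁆ (subst (w ∈_) eq w∈i))
          where
          v∈i : v ∈ part i
          v∈i = subst (v ∈_) (sym eq) (x∈p∪q⁺ (inj₂ (x∈⁅x⁆ v)))
          w∈i : w ∈ part i
          w∈i = subst (λ j → w ∈ part j) (trans (index-≡ cw≡cv) (index-unique v∈i)) (∈-index w)

      -- The hub of a part is not moved, which leaves at most `∣ part i ∣ ∸ 1` moved vertices in it.
      moved≤weight : ∣ moved c ∣ ≤ weight P
      moved≤weight = sum-cover (λ i → ∣ part i ∣ ∸ 1) (λ i → part i - hub i) (moved c)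
        (λ i → ≤-reflexive (∣p-x∣≡∣p∣∸1 (hub∈ i)))
        (λ {v} v∈ → index v , x∈p∧x≢y⇒x∈p-y (∈-index v) (≢-sym (∈-subset⁻ (moved? c) v∈)))

    partition⇒swapSet : IsTree T → Fin n → ∃[ D ] (SwapSet T D × ∣ D ∣ ≤ weight P)
    partition⇒swapSet tree r =
      let (c′ , S′ , none , le) = no-excess record
            { idem = c-≡ ∘ index-c ; adjacent = adjacent ; isolated = isolated ; escape = escape }
          (D , swap , le′) = matching⇒swapSet tree r S′ none
      in D , swap , ≤-trans le′ (≤-trans le moved≤weight)

-- From swap sets to star partitionings

  module FromSwapSet {D : Subset n} (swap : SwapSet T D) where

    D′ : Subset n
    D′ = proj₁ (proj₂ swap)

    ∣D∣≡∣D′∣ : ∣ D ∣ ≡ ∣ D′ ∣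
    ∣D∣≡∣D′∣ = proj₁ (proj₂ (proj₂ (proj₂ (proj₂ swap))))

    matching : PerfectMatching T D D′
    matching = proj₂ (proj₂ (proj₂ (proj₂ (proj₂ swap))))

    disjoint : ∀ {v} → v ∈ D → v ∉ D′
    disjoint v∈D v∈D′ = proj₁ (proj₂ (proj₂ (proj₂ swap))) (_ , x∈p∩q⁺ (v∈D , v∈D′))

    private
      module F = Inverse (⤖⇒↔ (proj₁ matching))

    abstract
      -- The bijection and its inverse are joined to one map on all vertices, known below only
      -- through `m-to` and `m-from`.
      m : Fin n → Fin n
      m v with v ∈? D | v ∈? D′
      ... | yes v∈ | _      = proj₁ (F.to (v , v∈))
      ... | no _   | yes v∈ = proj₁ (F.from (v , v∈))
      ... | no _   | no _   = v

      m-to : ∀ {v} (v∈ : v ∈ D) → m v ≡ proj₁ (F.to (v , v∈))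
      m-to {v} v∈ with v ∈? D
      ... | yes v∈′ = cong (λ z → proj₁ (F.to (v , z))) ([]=-irrelevant v∈′ v∈)
      ... | no v∉   = contradiction v∈ v∉

      m-from : ∀ {v} (v∈ : v ∈ D′) → m v ≡ proj₁ (F.from (v , v∈))
      m-from {v} v∈ with v ∈? D | v ∈? D′
      ... | yes v∈D | _       = contradiction v∈ (disjoint v∈D)
      ... | no _    | yes v∈′ = cong (λ z → proj₁ (F.from (v , z))) ([]=-irrelevant v∈′ v∈)
      ... | no _    | no v∉   = contradiction v∈ v∉

    m-D : ∀ {v} → v ∈ D → m v ∈ D′
    m-D v∈ = subst (_∈ D′) (sym (m-to v∈)) (proj₂ (F.to (_ , v∈)))

    m-D′ : ∀ {v} → v ∈ D′ → m v ∈ D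
    m-D′ v∈ = subst (_∈ D) (sym (m-from v∈)) (proj₂ (F.from (_ , v∈)))

    Matched : Fin n → Set
    Matched v = v ∈ D ⊎ v ∈ D′

    m-inv : ∀ {v} → Matched v → m (m v) ≡ v
    m-inv {v} (inj₁ v∈) = trans (cong m (m-to v∈))
      (trans (m-from (proj₂ (F.to (v , v∈)))) (cong proj₁ (F.strictlyInverseʳ (v , v∈))))
    m-inv {v} (inj₂ v∈) = trans (cong m (m-from v∈))
      (trans (m-to (proj₂ (F.from (v , v∈)))) (cong proj₁ (F.strictlyInverseˡ (v , v∈))))

    m-injective : ∀ {v w} → Matched v → Matched w → m v ≡ m w → v ≡ w
    m-injective Mv Mw eq = trans (sym (m-inv Mv)) (trans (cong m eq) (m-inv Mw))

    m-adj : ∀ {v} → Matched v → Adj v (m v)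
    m-adj {v} (inj₁ v∈) = subst (Adj v) (sym (m-to v∈)) (proj₂ matching (v , v∈))
    m-adj {v} (inj₂ v∈) = adj-sym (subst (Adj (m v)) (m-inv (inj₂ v∈)) (m-adj (inj₁ (m-D′ v∈))))

    m-≢ : ∀ {v} → Matched v → m v ≢ v
    m-≢ {v} Mv eq = adj-irrefl (subst (Adj v) eq (m-adj Mv))

    matched-or-dominated : ∀ v →
      Matched v ⊎ ((∃[ u ] (u ∈ D × Adj u v)) × (∃[ u ] (u ∈ D′ × Adj u v)))
    matched-or-dominated v with proj₁ swap v | proj₁ (proj₂ (proj₂ swap)) v
    ... | inj₁ v∈ | _       = inj₁ (inj₁ v∈)
    ... | inj₂ _  | inj₁ v∈ = inj₁ (inj₂ v∈)
    ... | inj₂ d  | inj₂ d′ = inj₂ (d , d′)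

    leaf-neighbour : ∀ {l a b} → Leaf T l → Adj l a → Adj l b → a ≡ b
    leaf-neighbour {l} leaf la lb = ∣p∣≡1⇒x≡y leaf (∈-subset⁺ (adj? l) la) (∈-subset⁺ (adj? l) lb)

    -- An unmatched vertex has a neighbour in `D` and another in `D′`, whereas a leaf has only one
    -- neighbour.
    leaf-matched : ∀ {l} → Leaf T l → Matched l
    leaf-matched {l} leaf with matched-or-dominated l
    ... | inj₁ Ml = Ml
    ... | inj₂ ((u , u∈ , ul) , (u′ , u′∈ , u′l)) =
      contradiction (subst (_∈ D′) (leaf-neighbour leaf (adj-sym u′l) (adj-sym ul)) u′∈) (disjoint u∈)

    leaf-partner : ∀ {l v} → Leaf T l → Adj v l → m l ≡ v
    leaf-partner leaf vl = leaf-neighbour leaf (m-adj (leaf-matched leaf)) (adj-sym vl)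

    -- Two leaves at `v` would both have `v` as their partner.
    swapSet⇒weak : IsWeak T
    swapSet⇒weak (v , u , w , u≢w , vu , vw , u-leaf , w-leaf) =
      u≢w (m-injective (leaf-matched u-leaf) (leaf-matched w-leaf)
             (trans (leaf-partner u-leaf vu) (sym (leaf-partner w-leaf vw))))

    2∣D∣≤n : ∣ D ∣ + ∣ D ∣ ≤ n
    2∣D∣≤n = ≤-trans (≤-reflexive (cong (∣ D ∣ +_) ∣D∣≡∣D′∣))
      (≤-trans (∣∣-disjoint {r = D ∪ D′} (λ v∈ → x∈p∪q⁺ (inj₁ v∈)) (λ v∈ → x∈p∪q⁺ (inj₂ v∈)) disjoint)
               (∣p∣≤n (D ∪ D′)))

    perfect⇒matched : ∣ D ∣ + ∣ D ∣ ≡ n → ∀ v → Matched v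
    perfect⇒matched eq v = x∈p∪q⁻ D D′ (subst (v ∈_) (sym (∣p∣≡n⇒p≡⊤ full)) ∈⊤)
      where
      full : ∣ D ∪ D′ ∣ ≡ n
      full = ≤-antisym (∣p∣≤n (D ∪ D′))
        (≤-trans (≤-reflexive (trans (sym eq) (cong (∣ D ∣ +_) ∣D∣≡∣D′∣)))
                 (∣∣-disjoint (λ v∈ → x∈p∪q⁺ (inj₁ v∈)) (λ v∈ → x∈p∪q⁺ (inj₂ v∈)) disjoint))

    -- An independent set contains at most one end of each edge of the matching.
    independent≤ : (∀ v → Matched v) → ∀ I → Independent T I → ∣ I ∣ ≤ ∣ D ∣
    independent≤ matched I indep = ∣∣-injection I D g (λ {v} _ → g∈ v) g-injective
      where
      g : Fin n → Fin n
      g v with v ∈? D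
      ... | yes _ = v
      ... | no _  = m v
      g∈ : ∀ v → g v ∈ D
      g∈ v with v ∈? D | matched v
      ... | yes v∈ | _       = v∈
      ... | no v∉  | inj₁ v∈ = contradiction v∈ v∉
      ... | no _   | inj₂ v∈ = m-D′ v∈
      g-injective : ∀ {v w} → v ∈ I → w ∈ I → g v ≡ g w → v ≡ w
      g-injective {v} {w} v∈ w∈ eq with v ∈? D | w ∈? D
      ... | yes _ | yes _ = eq
      ... | yes _ | no _  = contradiction (subst (Adj w) (sym eq) (m-adj (matched w))) (indep w∈ v∈)
      ... | no _  | yes _ = contradiction (subst (Adj v) eq (m-adj (matched v))) (indep v∈ w∈)
      ... | no _  | no _  = m-injective (matched v) (matched w) eq

    private
      -- The vertices of `D` serve as centres of the K₂ parts, so that only vertices of `D′` are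
      -- moved and the weight is at most `∣ D′ ∣`.
      c : Fin n → Fin n
      c v with v ∈? D′
      ... | yes _ = m v
      ... | no _  = v

      c-D′ : ∀ {v} → v ∈ D′ → c v ≡ m v
      c-D′ {v} v∈ with v ∈? D′
      ... | yes _ = refl
      ... | no v∉ = contradiction v∈ v∉

      c-∉D′ : ∀ {v} → v ∉ D′ → c v ≡ v
      c-∉D′ {v} v∉ with v ∈? D′
      ... | yes v∈ = contradiction v∈ v∉
      ... | no _   = refl

      c-D : ∀ {v} → v ∈ D → c v ≡ v
      c-D v∈ = c-∉D′ (disjoint v∈)

      c-moved : ∀ {v} → c v ≢ v → v ∈ D′
      c-moved {v} cv≢v with v ∈? D′
      ... | yes v∈ = v∈
      ... | no _   = contradiction refl cv≢v

      c-idem : ∀ v → c (c v) ≡ c v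
      c-idem v with v ∈? D′
      ... | yes v∈ = c-D (m-D′ v∈)
      ... | no v∉  = c-∉D′ v∉

      c-m : ∀ {v} → Matched v → c (m v) ≡ c v
      c-m (inj₁ v∈) = trans (c-D′ (m-D v∈)) (trans (m-inv (inj₁ v∈)) (sym (c-D v∈)))
      c-m (inj₂ v∈) = trans (c-D (m-D′ v∈)) (sym (c-D′ v∈))

      same-part : ∀ {u v} → Matched v → c u ≡ c v → u ≡ v ⊎ u ≡ m v
      same-part {u} {v} Mv eq with u ∈? D′ | v ∈? D′
      ... | yes u∈ | yes v∈ = inj₁ (m-injective (inj₂ u∈) (inj₂ v∈) eq)
      ... | yes u∈ | no v∉  = inj₂ (trans (sym (m-inv (inj₂ u∈))) (cong m eq))
      ... | no u∉  | yes v∈ = inj₂ eq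
      ... | no u∉  | no v∉  = inj₁ eq

    swapPartition : Partition n
    swapPartition = fibrePartition c c-idem

    weight-swapPartition : weight swapPartition ≤ ∣ D ∣
    weight-swapPartition = ≤-trans (weight-fibrePartition c c-idem D′ c-moved) (≤-reflexive (sym ∣D∣≡∣D′∣))

    open Partition swapPartition

    private
      hub : Fin size → Fin n
      hub = centre c c-idem

      ∈-part⁺ : ∀ {i v} → c v ≡ hub i → v ∈ part i
      ∈-part⁺ = ∈-fibre⁺ c c-idem

      ∈-part⁻ : ∀ {i v} → v ∈ part i → c v ≡ hub i
      ∈-part⁻ = ∈-fibre⁻ c c-idem

      matched⇒≢1 : ∀ {i v} → Matched v → v ∈ part i → ∣ part i ∣ ≢ 1
      matched⇒≢1 {i} Mv v∈ ≡1 =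
        m-≢ Mv (∣p∣≡1⇒x≡y ≡1 (∈-part⁺ (trans (c-m Mv) (∈-part⁻ v∈))) v∈)

      hub-fixed : ∀ i → c (hub i) ≡ hub i
      hub-fixed = centre-fixed c c-idem

      part-adj : ∀ {i u} → u ∈ part i → u ≢ hub i → u ∈ D′ × m u ≡ hub i
      part-adj u∈ u≢ =
        let u∈D′ = c-moved (λ cu≡u → u≢ (trans (sym cu≡u) (∈-part⁻ u∈)))
        in u∈D′ , trans (sym (c-D′ u∈D′)) (∈-part⁻ u∈)

    -- Ends of one star have the same partner and so coincide. A leaf is matched to its only
    -- neighbour, which gives the required K₂ parts. The vertex of a K₁ part is unmatched, hence
    -- dominated by both `D` and `D′`.
    swapPartition-simple : Acyclic T → IsSimpleStarPartitioning T swapPartition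
    swapPartition-simple acyclic = record
      { stars     = λ i → hub i , ∈-part⁺ (hub-fixed i) ,
          (λ {u} u∈ u≢ → let (u∈D′ , mu≡) = part-adj u∈ u≢ in
             adj-sym (subst (Adj u) mu≡ (m-adj (inj₂ u∈D′)))) ,
          (λ {u} u∈ w∈ u≢ w≢ uw →
             let (u∈D′ , mu≡) = part-adj u∈ u≢
                 (w∈D′ , mw≡) = part-adj w∈ w≢
             in adj-irrefl (subst (Adj u)
                  (m-injective (inj₂ w∈D′) (inj₂ u∈D′) (trans mw≡ (sym mu≡))) uw))
      ; leafPairs = leafPairs
      ; isolated  = isolated
      }
      where
      leafPairs : ∀ v l → OnlyLeafOf T v l → ∃[ i ] part i ≡ ⁅ v ⁆ ∪ ⁅ l ⁆
      leafPairs v l (vl , leaf , _) = i , ⊆-antisym ⊆₁ ⊆₂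
        where
        Ml : Matched l
        Ml = leaf-matched leaf
        ml≡v : m l ≡ v
        ml≡v = leaf-partner leaf vl
        i : Fin size
        i = proj₁ (covers l)
        cl : c l ≡ hub i
        cl = ∈-part⁻ (proj₁ (proj₂ (covers l)))
        ⊆₁ : part i ⊆ ⁅ v ⁆ ∪ ⁅ l ⁆
        ⊆₁ {u} u∈ with same-part {u} Ml (trans (∈-part⁻ u∈) (sym cl))
        ... | inj₁ refl = x∈p∪q⁺ (inj₂ (x∈⁅x⁆ l))
        ... | inj₂ u≡ml = x∈p∪q⁺ (inj₁ (subst (_∈ ⁅ v ⁆) (sym (trans u≡ml ml≡v)) (x∈⁅x⁆ v)))
        ⊆₂ : ⁅ v ⁆ ∪ ⁅ l ⁆ ⊆ part i
        ⊆₂ {u} u∈ with x∈p∪q⁻ ⁅ v ⁆ ⁅ l ⁆ u∈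
        ... | inj₁ u∈v = ∈-part⁺ (trans (cong c (trans (x∈⁅y⁆⇒x≡y v u∈v) (sym ml≡v))) (trans (c-m Ml) cl))
        ... | inj₂ u∈l = ∈-part⁺ (trans (cong c (x∈⁅y⁆⇒x≡y l u∈l)) cl)

      isolated : ∀ i → ∣ part i ∣ ≡ 1 →
        ∃[ j ] ∃[ k ] ( j ≢ k
                      × ∣ part j ∣ ≢ 1 × PartsAdjacent T (part i) (part j)
                      × ∣ part k ∣ ≢ 1 × PartsAdjacent T (part i) (part k))
      isolated i ≡1 with matched-or-dominated (hub i)
      ... | inj₁ Mx = contradiction ≡1 (matched⇒≢1 Mx (∈-part⁺ (hub-fixed i)))
      ... | inj₂ ((u , u∈D , ux) , (w , w∈D′ , wx)) =
        proj₁ (covers u) , proj₁ (covers w) , j≢k ,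
        matched⇒≢1 (inj₁ u∈D) u∈ , (hub i , u , ∈-part⁺ (hub-fixed i) , u∈ , adj-sym ux) ,
        matched⇒≢1 (inj₂ w∈D′) w∈ , (hub i , w , ∈-part⁺ (hub-fixed i) , w∈ , adj-sym wx)
        where
        u∈ : u ∈ part (proj₁ (covers u))
        u∈ = proj₁ (proj₂ (covers u))
        w∈ : w ∈ part (proj₁ (covers w))
        w∈ = proj₁ (proj₂ (covers w))
        j≢k : proj₁ (covers u) ≢ proj₁ (covers w)
        -- In a common part `u` and `w` would be partners, and so form a triangle with `hub i`.
        j≢k eq = no-triangle T acyclic wu ux wx
          where
          mw≡u : m w ≡ u
          mw≡u = trans (sym (c-D′ w∈D′)) (trans (∈-part⁻ w∈)
                   (trans (cong hub (sym eq)) (trans (sym (∈-part⁻ u∈)) (c-D u∈D))))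
          wu : Adj w u
          wu = subst (Adj w) mw≡u (m-adj (inj₂ w∈D′))

  -- Bipartition of a tree

  bipartition : IsTree T → Fin n →
    ∃[ A ] ∃[ B ] (Independent T A × Independent T B × n ≤ ∣ A ∣ + ∣ B ∣)
  bipartition (connected , acyclic) r =
    A true , A false , independent true , independent false ,
    ≤-trans (≤-reflexive (sym (∣⊤∣≡n n))) (∣∣-cover {r = ⊤} λ {v} _ → cover v)
    where
    colours : ∃[ colour ] ((∀ {x} → Adj x x → colour x ≡ colour x)
                         × (∀ {u v} → Adj u v → u ≢ v → v ≢ u → colour v ≡ not (colour u)))
    -- With the identity in place of `p` no edge is marked, so the colour changes along every edge.
    colours = colouring T acyclic connected r id
    colour : Fin n → Bool
    colour = proj₁ colours
    class? : ∀ d → Decidable (λ v → colour v ≡ d)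
    class? d v = colour v Bool.≟ d
    A : Bool → Subset n
    A d = subset (class? d)
    independent : ∀ d → Independent T (A d)
    independent d {u} {v} u∈ v∈ uv = not-¬ {colour u} refl
      (trans (∈-subset⁻ (class? d) u∈) (trans (sym (∈-subset⁻ (class? d) v∈))
        (proj₂ (proj₂ colours) uv u≢v (≢-sym u≢v))))
      where
      u≢v : u ≢ v
      u≢v refl = adj-irrefl uv
    cover : ∀ v → v ∈ A true ⊎ v ∈ A false
    cover v with colour v in eq
    ... | true  = inj₁ (∈-subset⁺ (class? true) eq)
    ... | false = inj₂ (∈-subset⁺ (class? false) eq)

-- Comparing the invariants with half the order

2*k≡k+k : ∀ k → 2 * k ≡ k + k
2*k≡k+k k = cong (k +_) (ℕ.+-identityʳ k)

theorem24 : ∀ (n : ℕ) → 2 ≤ n → (T : Graph n) → IsTree T →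
    (∃[ k ] (IsIndependenceNumber T k × IsSwapNumber T [ k ]))
    ⇔ (IsWeak T × (∃[ s ] (IsStarWeight T s × 2 * s ≡ n)))
theorem24 n@(suc _) 2≤n T tree = mk⇔ to from
  where
  -- Any vertex can serve as the root of the colourings; `2 ≤ n` guarantees one.
  r : Fin n
  r = zero

  to : (∃[ k ] (IsIndependenceNumber T k × IsSwapNumber T [ k ])) →
       IsWeak T × (∃[ s ] (IsStarWeight T s × 2 * s ≡ n))
  to (k , (_ , α≤k) , (D , swap , refl) , k≤swap) =
    -- The partition made from `D` has weight at most `k`, and a lighter one would yield a swap set
    -- with fewer than `k` vertices.
    swapSet⇒weak , k , ((swapPartition , simple , ≤-antisym weight-swapPartition (k≤weight swapPartition simple)) , k≤weight) ,
    trans (2*k≡k+k k) (≤-antisym 2∣D∣≤n n≤2k)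
    where
    open FromSwapSet T swap
    simple : IsSimpleStarPartitioning T swapPartition
    simple = swapPartition-simple (proj₂ tree)
    k≤weight : ∀ P → IsSimpleStarPartitioning T P → k ≤ weight P
    k≤weight P simpleP =
      let (E , swapE , E≤) = partition⇒swapSet T swapSet⇒weak simpleP tree r
      in ≤-trans (k≤swap E swapE) E≤
    -- Both colour classes are independent, so neither exceeds the independence number `k`.
    n≤2k : n ≤ k + k
    n≤2k = let (A , B , indA , indB , n≤) = bipartition T tree r
           in ≤-trans n≤ (+-mono-≤ (α≤k A indA) (α≤k B indB))

  from : IsWeak T × (∃[ s ] (IsStarWeight T s × 2 * s ≡ n)) →
         ∃[ k ] (IsIndependenceNumber T k × IsSwapNumber T [ k ])
  from (weak , s , ((P , simple , refl) , s≤weight) , 2s≡n) =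
    s , ((half , α≤s) , (D , swap , ∣D∣≡s) , s≤swap)
    where
    s≤swap : ∀ E → SwapSet T E → s ≤ ∣ E ∣
    s≤swap E swapE = ≤-trans (s≤weight swapPartition (swapPartition-simple (proj₂ tree))) weight-swapPartition
      where open FromSwapSet T swapE
    found : ∃[ D ] (SwapSet T D × ∣ D ∣ ≤ s)
    found = partition⇒swapSet T weak simple tree r
    D : Subset n
    D = proj₁ found
    swap : SwapSet T D
    swap = proj₁ (proj₂ found)
    ∣D∣≡s : ∣ D ∣ ≡ s
    ∣D∣≡s = ≤-antisym (proj₂ (proj₂ found)) (s≤swap D swap)
    s+s≡n : s + s ≡ n
    s+s≡n = trans (sym (2*k≡k+k s)) 2s≡n
    open FromSwapSet T swap using (independent≤; perfect⇒matched)
    α≤s : ∀ I → Independent T I → ∣ I ∣ ≤ s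
    α≤s I indep = ≤-trans
      -- `D` and its disjoint partner set have `s + s` vertices together, which is all of them.
      (independent≤ (perfect⇒matched (trans (cong₂ _+_ ∣D∣≡s ∣D∣≡s) s+s≡n)) I indep)
      (≤-reflexive ∣D∣≡s)
    half : ∃[ I ] (Independent T I × ∣ I ∣ ≡ s)
    half =
      let (A , B , indA , indB , n≤) = bipartition T tree r
      -- `B` contains at most `s` of the `s + s` vertices, which leaves at least `s` for `A`.
      in A , indA , ≤-antisym (α≤s A indA)
           (ℕ.+-cancelʳ-≤ s s ∣ A ∣ (≤-trans (≤-reflexive s+s≡n)
             (≤-trans n≤ (ℕ.+-monoʳ-≤ ∣ A ∣ (α≤s B indB)))))
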